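{- Let $K$ be a number field, let $\varphi:\mathbb{P}^1\to\mathbb{P}^1$ be a rational map of degree $\ge 2$ defined over $K$, and let $\beta\in\mathbb{P}^1(K)$. Suppose the number of Galois orbits for $\varphi^{ -n}(\beta)$ is bounded by a constant independent of $n$. Then there exists an integer $l\ge 0$ such that for each $\beta_{l,i}\in\varphi^{ -l}(\beta)$ and each $m\ge 0$, the points in $\varphi^{ -m}(\beta_{l,i})$ are all Galois conjugates over $K$.
   Context: $\varphi^n$ denotes the $n$-th iterate of $\varphi$ and $\varphi^{ -n}(\beta)\subset\mathbb{P}^1(\overline{K})$ is the set of preimages of $\beta$ under $\varphi^n$. The Galois orbits for $\varphi^{ -n}(\beta)$ are the orbits of $\mathrm{Gal}(\overline{K}/K)$ acting on this set; points are Galois conjugates over $K$ if they lie in one orbit of $\mathrm{Gal}(\overline{K}/K)$ on $\mathbb{P}^1(\overline{K})$. -}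

module Defs where

open import Algebra.Apartness.Bundles using (HeytingCommutativeRing; HeytingField)
import Algebra.Apartness.Properties.HeytingCommutativeRing as HeytingProperties
open import Algebra.Bundles using (CommutativeRing)
open import Algebra.Morphism.Structures using (module RingMorphisms)
import Algebra.Morphism.Construct.Composition as Comp
import Algebra.Morphism.Construct.Identity as Identity
import Algebra.Properties.CommutativeSemiring.Exp as CommExp
import Algebra.Properties.CommutativeSemigroup as CSemigroup
import Algebra.Properties.Semiring.Sum as SemiringSum
open import Data.Fin.Base using (Fin; suc; toℕ)
open import Data.Fin.Properties using (toℕ≤pred[n])
open import Data.Nat.Base as ℕ using (ℕ; suc; _∸_)
open import Data.Nat.Properties using (m+[n∸m]≡n)
open import Data.Product.Base using (Σ; ∃; _×_; _,_; proj₁; proj₂)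
import Data.Rational.Properties as ℚ
open import Data.Sum.Base as Sum using (_⊎_)
open import Data.Vec.Functional using (Vector; map)
open import Function.Bundles using (Func; Bijection)
open import Level using (Level; 0ℓ; _⊔_) renaming (suc to lsuc)
open import Relation.Binary.Bundles using (Setoid)
import Relation.Binary.PropositionalEquality as ≡
import Relation.Binary.Construct.On as On
import Relation.Binary.Reasoning.Setoid as ≈-Reasoning
open import Relation.Unary using (Pred)
import Function.Endo.Setoid as Endo

private variable
  c ℓ₁ ℓ₂ c′ ℓ₁′ ℓ₂′ : Level

-- "Field" is the library's HeytingField.  Under excluded middle the tight
-- apartness x # y is just the negation of x ≈ y, so this is a field in the
-- usual sense; the zero ring is excluded because 1# # 0# is derivable.

module FieldOps (F : HeytingField c ℓ₁ ℓ₂) where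

  open HeytingField F public using (_#_; heytingCommutativeRing)

  commutativeRing : CommutativeRing c ℓ₁
  commutativeRing = HeytingCommutativeRing.commutativeRing heytingCommutativeRing

  open CommutativeRing commutativeRing public
  open CommExp commutativeSemiring public
  open SemiringSum semiring public using (sum; sum-cong-≋; *-distribˡ-sum)
  open HeytingProperties heytingCommutativeRing public

  inverse : ∀ {x} → x # 0# → ∃ λ x⁻¹ → x⁻¹ * x ≈ 1#
  inverse {x} x#0 with HeytingField.#⇒invertible F x#0
  ... | x⁻¹ , x⁻¹x≈1 , _ = x⁻¹ , trans (*-congˡ (sym (x-0≈x x))) x⁻¹x≈1

  invertible⇒#0 : ∀ {x x⁻¹} → x⁻¹ * x ≈ 1# → x # 0#
  invertible⇒#0 {x} {x⁻¹} x⁻¹x≈1 =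
    invertibleˡ⇒# (x⁻¹ , trans (*-congˡ (x-0≈x x)) x⁻¹x≈1)

  -- The coefficient of Xⁱ is a i.
  evalPoly : ∀ {n} → Vector Carrier n → Carrier → Carrier
  evalPoly a x = sum λ i → a i * x ^ toℕ i

  -- The coefficient of Xⁱ Yᵈ⁻ⁱ is a i.
  formTerm : ∀ {d} → Vector Carrier (suc d) → Carrier → Carrier → Vector Carrier (suc d)
  formTerm {d} a x y i = a i * (x ^ toℕ i * y ^ (d ∸ toℕ i))

  evalForm : ∀ {d} → Vector Carrier (suc d) → Carrier → Carrier → Carrier
  evalForm a x y = sum (formTerm a x y)

  evalForm-cong : ∀ {d} (a : Vector Carrier (suc d)) {x x′ y y′} →
                  x ≈ x′ → y ≈ y′ → evalForm a x y ≈ evalForm a x′ y′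
  evalForm-cong {d} a {x} {x′} {y} {y′} x≈x′ y≈y′ =
    sum-cong-≋ {x = formTerm a x y} {formTerm a x′ y′} λ i →
      *-congˡ (*-cong (^-congˡ (toℕ i) x≈x′) (^-congˡ (d ∸ toℕ i) y≈y′))

  evalForm-homogeneous : ∀ {d} (a : Vector Carrier (suc d)) s x y →
    evalForm a (s * x) (s * y) ≈ s ^ d * evalForm a x y
  evalForm-homogeneous {d} a s x y = trans
    (sum-cong-≋ {x = formTerm a (s * x) (s * y)} {map (s ^ d *_) (formTerm a x y)} term)
    (sym (*-distribˡ-sum (s ^ d) (formTerm a x y)))
    where
    open ≈-Reasoning setoid
    open CSemigroup *-commutativeSemigroup using (interchange; x∙yz≈y∙xz)
    term : ∀ i → formTerm a (s * x) (s * y) i ≈ s ^ d * formTerm a x y i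
    term i = begin
      a i * ((s * x) ^ k * (s * y) ^ k′)
        ≈⟨ *-congˡ (*-cong (^-distrib-* s x k) (^-distrib-* s y k′)) ⟩
      a i * ((s ^ k * x ^ k) * (s ^ k′ * y ^ k′))
        ≈⟨ *-congˡ (interchange _ _ _ _) ⟩
      a i * ((s ^ k * s ^ k′) * (x ^ k * y ^ k′))
        ≈⟨ *-congˡ (*-congʳ (^-homo-* s k k′)) ⟨
      a i * (s ^ (k ℕ.+ k′) * (x ^ k * y ^ k′))
        ≈⟨ *-congˡ (*-congʳ (^-congʳ s (m+[n∸m]≡n (toℕ≤pred[n] i)))) ⟩
      a i * (s ^ d * (x ^ k * y ^ k′))
        ≈⟨ x∙yz≈y∙xz _ _ _ ⟩
      s ^ d * (a i * (x ^ k * y ^ k′)) ∎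
      where
      k k′ : ℕ
      k  = toℕ i
      k′ = d ∸ k

  ^-#0 : ∀ {s} n → s # 0# → s ^ n # 0#
  ^-#0 ℕ.zero    s#0 = 1#0
  ^-#0 (ℕ.suc n) s#0 = x#0y#0→xy#0 s#0 (^-#0 n s#0)

  NonZeroPair : Carrier → Carrier → Set ℓ₂
  NonZeroPair x y = x # 0# ⊎ y # 0#

  record Point : Set (c ⊔ ℓ₂) where
    constructor [_∶_]⟨_⟩
    field
      X Y     : Carrier
      nonzero : NonZeroPair X Y

  infix 4 _∼_
  record _∼_ (P Q : Point) : Set (c ⊔ ℓ₁ ⊔ ℓ₂) where
    constructor scaleBy
    field
      scale   : Carrier
      scale#0 : scale # 0#
      X≈      : Point.X Q ≈ scale * Point.X P
      Y≈      : Point.Y Q ≈ scale * Point.Y P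

  coords⇒∼ : ∀ {P Q} → Point.X Q ≈ Point.X P → Point.Y Q ≈ Point.Y P → P ∼ Q
  coords⇒∼ p q =
    scaleBy 1# 1#0 (trans p (sym (*-identityˡ _))) (trans q (sym (*-identityˡ _)))

  ∼-sym : ∀ {P Q} → P ∼ Q → Q ∼ P
  ∼-sym (scaleBy s s#0 p q) with inverse s#0
  ... | s⁻¹ , inv = scaleBy s⁻¹ (invertible⇒#0 (trans (*-comm s s⁻¹) inv)) (flip p) (flip q)
    where
    flip : ∀ {u v} → v ≈ s * u → u ≈ s⁻¹ * v
    flip {u} {v} v≈su = begin
      u              ≈⟨ *-identityˡ u ⟨
      1# * u         ≈⟨ *-congʳ inv ⟨
      s⁻¹ * s * u    ≈⟨ *-assoc s⁻¹ s u ⟩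
      s⁻¹ * (s * u)  ≈⟨ *-congˡ v≈su ⟨
      s⁻¹ * v        ∎
      where open ≈-Reasoning setoid

  ℙ¹ : Setoid (c ⊔ ℓ₂) (c ⊔ ℓ₁ ⊔ ℓ₂)
  ℙ¹ = record
    { Carrier       = Point
    ; _≈_           = _∼_
    ; isEquivalence = record
      { refl  = coords⇒∼ refl refl
      ; sym   = ∼-sym
      ; trans = λ { (scaleBy s s#0 p q) (scaleBy t t#0 p′ q′) →
          scaleBy (t * s) (x#0y#0→xy#0 t#0 s#0)
            (trans p′ (trans (*-congˡ p) (sym (*-assoc t s _))))
            (trans q′ (trans (*-congˡ q) (sym (*-assoc t s _)))) }
      }
    }

module _ (F : HeytingField c ℓ₁ ℓ₂) (E : HeytingField c′ ℓ₁′ ℓ₂′) where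

  private
    module F = FieldOps F
    module E = FieldOps E
  open RingMorphisms F.rawRing E.rawRing

  record FieldHom : Set (c ⊔ ℓ₁ ⊔ c′ ⊔ ℓ₁′) where
    field
      ⟦_⟧                : F.Carrier → E.Carrier
      isRingHomomorphism : IsRingHomomorphism ⟦_⟧

    open IsRingHomomorphism isRingHomomorphism public

    #0-homo : ∀ {x} → x F.# F.0# → ⟦ x ⟧ E.# E.0#
    #0-homo x#0 with F.inverse x#0
    ... | x⁻¹ , inv = E.invertible⇒#0
      (E.trans (E.sym (*-homo x⁻¹ _)) (E.trans (⟦⟧-cong inv) 1#-homo))

    mapPoint : Func F.ℙ¹ E.ℙ¹
    mapPoint = record
      { to   = λ { F.[ x ∶ y ]⟨ nz ⟩ → E.[ ⟦ x ⟧ ∶ ⟦ y ⟧ ]⟨ Sum.map #0-homo #0-homo nz ⟩ }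
      ; cong = λ { (F.scaleBy s s#0 p q) → E.scaleBy ⟦ s ⟧ (#0-homo s#0)
                 (E.trans (⟦⟧-cong p) (*-homo s _))
                 (E.trans (⟦⟧-cong q) (*-homo s _)) }
      }

  IsFinite : FieldHom → Set _
  IsFinite ι = ∃ λ n → Σ (Vector E.Carrier n) λ e →
    ∀ x → ∃ λ (a : Vector F.Carrier n) → x E.≈ E.sum (λ i → ⟦ a i ⟧ E.* e i)
    where open FieldHom ι

  IsAlgebraic : FieldHom → Set _
  IsAlgebraic ι = ∀ x → ∃ λ n → ∃ λ (a : Vector F.Carrier n) →
    (∃ λ i → a i F.# F.0#) × E.evalPoly (map ⟦_⟧ a) x E.≈ E.0#
    where open FieldHom ι

IsAlgebraicallyClosed : HeytingField c ℓ₁ ℓ₂ → Set _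
IsAlgebraicallyClosed F = ∀ n (a : Vector Carrier (suc n)) →
  (∃ λ i → a (suc i) # 0#) → ∃ λ x → evalPoly a x ≈ 0#
  where open FieldOps F

record NumberField c ℓ₁ ℓ₂ : Set (lsuc (c ⊔ ℓ₁ ⊔ ℓ₂)) where
  field
    heytingField : HeytingField c ℓ₁ ℓ₂
    fromℚ        : FieldHom ℚ.heytingField heytingField
    finite       : IsFinite ℚ.heytingField heytingField fromℚ

record AlgebraicClosure (K : HeytingField c ℓ₁ ℓ₂) c′ ℓ₁′ ℓ₂′
       : Set (c ⊔ ℓ₁ ⊔ ℓ₂ ⊔ lsuc (c′ ⊔ ℓ₁′ ⊔ ℓ₂′)) where
  field
    heytingField        : HeytingField c′ ℓ₁′ ℓ₂′
    embed               : FieldHom K heytingField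
    algebraic           : IsAlgebraic K heytingField embed
    algebraicallyClosed : IsAlgebraicallyClosed heytingField

module Dynamics {K : HeytingField c ℓ₁ ℓ₂} (K̄ : AlgebraicClosure K c′ ℓ₁′ ℓ₂′) where

  open AlgebraicClosure K̄ using (embed) renaming (heytingField to L)
  private
    module K = FieldOps K
    module L = FieldOps L
  open FieldHom embed using (⟦_⟧; mapPoint)
  open RingMorphisms L.rawRing L.rawRing using (IsRingIsomorphism)

  evalOver : ∀ {d} → Vector K.Carrier (suc d) → L.Carrier → L.Carrier → L.Carrier
  evalOver a = L.evalForm (map ⟦_⟧ a)

  -- [numerator ∶ denominator], both homogeneous of the given degree with
  -- coefficients in K and without a common zero in ℙ¹(K̄), that is, written in
  -- lowest terms; so degree is the degree of the map itself.
  record RationalMap : Set (c ⊔ c′ ⊔ ℓ₂′) where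
    field
      degree                : ℕ
      numerator denominator : Vector K.Carrier (suc degree)
      noCommonZero : ∀ x y → L.NonZeroPair x y →
                     L.NonZeroPair (evalOver numerator x y) (evalOver denominator x y)

    toFunc : Func L.ℙ¹ L.ℙ¹
    toFunc = record
      { to   = λ { L.[ x ∶ y ]⟨ nz ⟩ →
                 L.[ evalOver numerator x y ∶ evalOver denominator x y ]⟨ noCommonZero x y nz ⟩ }
      ; cong = λ { (L.scaleBy s s#0 p q) → L.scaleBy (s L.^ degree) (L.^-#0 degree s#0)
                 (scaled (map ⟦_⟧ numerator) p q) (scaled (map ⟦_⟧ denominator) p q) }
      }
      where
      scaled : ∀ {d} (a : Vector L.Carrier (suc d)) {s x y x′ y′} →
               x′ L.≈ s L.* x → y′ L.≈ s L.* y →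
               L.evalForm a x′ y′ L.≈ s L.^ d L.* L.evalForm a x y
      scaled a p q = L.trans (L.evalForm-cong a p q) (L.evalForm-homogeneous a _ _ _)

  iterate : RationalMap → ℕ → L.Point → L.Point
  iterate φ n = Func.to (Endo._^_ L.ℙ¹ (RationalMap.toFunc φ) n)

  Preimage : RationalMap → ℕ → L.Point → Pred L.Point _
  Preimage φ n β α = iterate φ n α L.∼ β

  baseChange : K.Point → L.Point
  baseChange = Func.to mapPoint

  record Gal : Set (c ⊔ c′ ⊔ ℓ₁′) where
    field
      σ                 : L.Carrier → L.Carrier
      isRingIsomorphism : IsRingIsomorphism σ
      fixes             : ∀ a → σ ⟦ a ⟧ L.≈ ⟦ a ⟧

    open IsRingIsomorphism isRingIsomorphism public

    fieldHom : FieldHom L L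
    fieldHom = record { isRingHomomorphism = isRingHomomorphism }

    act : Func L.ℙ¹ L.ℙ¹
    act = FieldHom.mapPoint fieldHom

  record Conjugate (P Q : L.Point) : Set (c ⊔ c′ ⊔ ℓ₁′ ⊔ ℓ₂′) where
    constructor conjugateBy
    field
      gal  : Gal
      maps : Func.to (Gal.act gal) P L.∼ Q

  idGal : Gal
  idGal = record
    { isRingIsomorphism = Identity.isRingIsomorphism L.rawRing L.refl
    ; fixes             = λ _ → L.refl
    }

  infixr 9 _∘ᴳ_
  _∘ᴳ_ : Gal → Gal → Gal
  g ∘ᴳ h = record
    { isRingIsomorphism = Comp.isRingIsomorphism L.trans h.isRingIsomorphism g.isRingIsomorphism
    ; fixes             = λ a → L.trans (g.⟦⟧-cong (h.fixes a)) (g.fixes a)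
    }
    where
    module g = Gal g
    module h = Gal h

  module _ (g : Gal) where
    private module g = Gal g

    σ⁻¹ : L.Carrier → L.Carrier
    σ⁻¹ y = proj₁ (g.surjective y)

    σσ⁻¹ : ∀ y → g.σ (σ⁻¹ y) L.≈ y
    σσ⁻¹ y = proj₂ (g.surjective y) L.refl

    σ⁻¹-unique : ∀ {x y} → g.σ x L.≈ y → σ⁻¹ y L.≈ x
    σ⁻¹-unique p = g.injective (L.trans (σσ⁻¹ _) (L.sym p))

    invGal : Gal
    invGal = record
      { σ = σ⁻¹
      ; isRingIsomorphism = record
        { isRingMonomorphism = record
          { isRingHomomorphism = record
            { isSemiringHomomorphism = record
              { isNearSemiringHomomorphism = record
                { +-isMonoidHomomorphism = record
                  { isMagmaHomomorphism = record
                    { isRelHomomorphism = record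
                      { cong = λ x≈y → σ⁻¹-unique (L.trans (σσ⁻¹ _) (L.sym x≈y)) }
                    ; homo = λ x y → σ⁻¹-unique
                        (L.trans (g.+-homo _ _) (L.+-cong (σσ⁻¹ x) (σσ⁻¹ y)))
                    }
                  ; ε-homo = σ⁻¹-unique g.0#-homo
                  }
                ; *-homo = λ x y → σ⁻¹-unique
                    (L.trans (g.*-homo _ _) (L.*-cong (σσ⁻¹ x) (σσ⁻¹ y)))
                }
              ; 1#-homo = σ⁻¹-unique g.1#-homo
              }
            ; -‿homo = λ x → σ⁻¹-unique (L.trans (g.-‿homo _) (L.-‿cong (σσ⁻¹ x)))
            }
          ; injective = λ {x} {y} p →
              L.trans (L.sym (σσ⁻¹ x)) (L.trans (g.⟦⟧-cong p) (σσ⁻¹ y))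
          }
        ; surjective = λ x → g.σ x , λ p → σ⁻¹-unique (L.sym p)
        }
      ; fixes = λ a → σ⁻¹-unique (g.fixes a)
      }

  conjugacy : Setoid _ _
  conjugacy = record
    { Carrier       = L.Point
    ; _≈_           = Conjugate
    ; isEquivalence = record
      { refl  = conjugateBy idGal (L.coords⇒∼ L.refl L.refl)
      ; sym   = λ { {P} (conjugateBy g gP∼Q) → conjugateBy (invGal g)
          (ℙ.trans (Func.cong (Gal.act (invGal g)) (ℙ.sym gP∼Q)) (act-inverse g P)) }
      ; trans = λ { {P} (conjugateBy g gP∼Q) (conjugateBy h hQ∼R) → conjugateBy (h ∘ᴳ g)
          (ℙ.trans (∘-act h g P) (ℙ.trans (Func.cong (Gal.act h) gP∼Q) hQ∼R)) }
      }
    }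
    where
    module ℙ = Setoid L.ℙ¹

    ∘-act : ∀ h g P → Func.to (Gal.act (h ∘ᴳ g)) P L.∼
                      Func.to (Gal.act h) (Func.to (Gal.act g) P)
    ∘-act h g P = L.coords⇒∼ L.refl L.refl

    act-inverse : ∀ g P → Func.to (Gal.act (invGal g)) (Func.to (Gal.act g) P) L.∼ P
    act-inverse g P = L.coords⇒∼
      (L.sym (σ⁻¹-unique g L.refl)) (L.sym (σ⁻¹-unique g L.refl))

  -- The orbits of Gal on a set S of points (stable under Galois in all uses):
  -- the points of S, with conjugate points identified.
  Orbits : ∀ {p} → Pred L.Point p → Setoid _ _
  Orbits S = On.setoid {B = Σ L.Point S} conjugacy proj₁

HasCardinality : Setoid c ℓ₁ → ℕ → Set _
HasCardinality S k = Bijection (≡.setoid (Fin k)) S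

module Submission where

-- Since φ is surjective on ℙ¹(K̄) and commutes with Galois, φᵐ maps the orbits of
-- φ^{-(l+m)}(β) onto those of φ^{-l}(β).  Choosing l to maximise the number of orbits makes this
-- surjection of finite sets injective for every m; two points of φ^{-m}(α) with φˡ(α) = β both
-- map to α, so they are conjugate.

open import Defs
open import Algebra.Apartness.Bundles using (HeytingField)
import Algebra.Properties.CommutativeMonoid.Sum as CommutativeMonoidSum
import Algebra.Properties.CommutativeSemigroup as CommutativeSemigroup
import Algebra.Properties.Ring as RingProperties
open import Axiom.ExcludedMiddle using (ExcludedMiddle)
open import Data.Fin.Base using (Fin; zero; suc; toℕ; punchOut)
open import Data.Fin.Properties using (_≟_; any?; injective⇒≤; punchOut-injective)
open import Data.Nat.Base as ℕ using (ℕ; zero; suc; _∸_; _≤_; _<_)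
open import Data.Nat.Properties using (≤-trans; ≤-<-trans; <-irrefl; <⇒≤; ≮⇒≥; +-monoʳ-<; m≤m+n)
open import Data.Product.Base using (∃; _×_; _,_; proj₁; proj₂)
open import Data.Sum.Base using (inj₁; inj₂)
open import Data.Vec.Functional using (Vector; map)
import Function.Endo.Setoid as SetoidEndo
open import Function.Base using (_∘_)
open import Function.Bundles using (Bijection; Func)
open import Function.Definitions using (Congruent; Injective; StrictlySurjective)
open import Level using (Level; _⊔_; Lift; lift; lower)
open import Relation.Binary.Bundles using (Setoid)
open import Relation.Binary.PropositionalEquality as ≡ using (_≡_; _≢_)
import Relation.Binary.Reasoning.Setoid as ≈-Reasoning
open import Relation.Nullary.Decidable using (yes; no; map′)
open import Relation.Nullary.Negation using (contradiction)
open import Relation.Unary using (_∈_)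

private variable
  a b c ℓ₁ ℓ₂ c′ ℓ₁′ ℓ₂′ : Level

-- Maxima of bounded sequences and counting in finite sets.

lowerEM : ∀ b → ExcludedMiddle (a ⊔ b) → ExcludedMiddle a
lowerEM b em {P} = map′ lower lift (em {Lift b P})

-- While some value exceeds `k l`, `ascend` moves to it. Its argument `d` is fuel: each move raises
-- `k l` by at least one, so the invariant `C ≤ d + k l` survives lowering `d` by one. Once `d` is
-- zero, `k l` has reached the bound `C`.
bounded⇒maximum : ExcludedMiddle Level.zero → (k : ℕ → ℕ) → ∀ {C} → (∀ n → k n ≤ C) →
                  ∃ λ l → ∀ n → k n ≤ k l
bounded⇒maximum em k {C} k≤C = ascend C 0 (m≤m+n C (k 0))
  where
  ascend : ∀ d l → C ≤ d ℕ.+ k l → ∃ λ l → ∀ n → k n ≤ k l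
  ascend zero    l C≤kl = l , λ n → ≤-trans (k≤C n) C≤kl
  ascend (suc d) l C≤d+kl with em {∃ λ n → k l < k n}
  ... | yes (n , kl<kn) = ascend d n (≤-trans C≤d+kl (+-monoʳ-< d kl<kn))
  ... | no  maximal     = l , λ n → ≮⇒≥ λ kl<kn → maximal (n , kl<kn)

-- Pigeonhole: if `i` were missed, punching it out of the codomain would leave an injection of
-- `Fin m` into a set with fewer than `m` elements.
Fin-injective⇒surjective : ∀ {m n} (f : Fin m → Fin n) → Injective _≡_ _≡_ f → n ≤ m →
                           StrictlySurjective _≡_ f
Fin-injective⇒surjective {m} {suc n} f inj n<m i with any? (λ j → f j ≟ i)
... | yes hit  = hit
... | no  miss = contradiction (≤-<-trans (injective⇒≤ avoid-injective) n<m) (<-irrefl ≡.refl)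
  where
  i≢f : ∀ j → i ≢ f j
  i≢f j i≡fj = miss (j , ≡.sym i≡fj)
  avoid : Fin m → Fin n
  avoid j = punchOut (i≢f j)
  avoid-injective : Injective _≡_ _≡_ avoid
  avoid-injective {j} {j′} eq = inj (punchOut-injective (i≢f j) (i≢f j′) eq)

module _ {S : Setoid a ℓ₁} {T : Setoid b ℓ₂} where

  private
    module S = Setoid S
    module T = Setoid T

  -- Chosen preimages form a `section` from the indices of `T` to `S`, and following it by the
  -- numbering of `S` is injective from `Fin n` to `Fin m`. As `m ≤ n`, this composite is
  -- surjective, so every element of `S` is equivalent to some `section t`, where `t` is the index
  -- of its image under `f`.
  surjective⇒injective : ∀ {m n} → HasCardinality S m → HasCardinality T n → m ≤ n →
    (f : S.Carrier → T.Carrier) → Congruent S._≈_ T._≈_ f → StrictlySurjective T._≈_ f →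
    Injective S._≈_ T._≈_ f
  surjective⇒injective {m} {n} #S #T m≤n f f-cong surj {x} {y} fx≈fy
    with hit x | hit y
    where
    module #S = Bijection #S
    module #T = Bijection #T
    open ≈-Reasoning T

    section : Fin n → S.Carrier
    section t = proj₁ (surj (#T.to t))

    code : S.Carrier → Fin m
    code x = proj₁ (#S.surjective x)

    decode-code : ∀ x → #S.to (code x) S.≈ x
    decode-code x = proj₂ (#S.surjective x) ≡.refl

    code-reflects-≈ : ∀ {x y} → code x ≡ code y → x S.≈ y
    code-reflects-≈ {x} {y} eq =
      S.trans (S.sym (decode-code x)) (S.trans (#S.cong eq) (decode-code y))

    code-section-injective : Injective _≡_ _≡_ (code ∘ section)
    code-section-injective {t} {t′} eq = #T.injective (begin
      #T.to t         ≈⟨ proj₂ (surj (#T.to t)) ⟨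
      f (section t)   ≈⟨ f-cong (code-reflects-≈ eq) ⟩
      f (section t′)  ≈⟨ proj₂ (surj (#T.to t′)) ⟩
      #T.to t′        ∎)

    hit : ∀ x → ∃ λ t → section t S.≈ x × #T.to t T.≈ f x
    hit x with Fin-injective⇒surjective (code ∘ section) code-section-injective m≤n (code x)
    ... | t , eq = t , s≈x , T.trans (T.sym (proj₂ (surj (#T.to t)))) (f-cong s≈x)
      where s≈x = code-reflects-≈ eq
  ... | t , st≈x , t≈fx | t′ , st′≈y , t′≈fy
    -- Equivalent images have equal indices, so `x` and `y` are equivalent to the same `section t`.
    with Bijection.injective #T (T.trans t≈fx (T.trans fx≈fy (T.sym t′≈fy)))
  ... | ≡.refl = S.trans (S.sym st≈x) st′≈y

-- Binary forms over a field and points of the projective line.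

module Forms (F : HeytingField c ℓ₁ ℓ₂) where

  open FieldOps F
  open CommutativeMonoidSum +-commutativeMonoid using (∑-distrib-+; sum-replicate-zero)
  open CommutativeSemigroup *-commutativeSemigroup using (xy∙z≈xz∙y)
  open ≈-Reasoning setoid

  1^n≈1 : ∀ n → 1# ^ n ≈ 1#
  1^n≈1 zero    = refl
  1^n≈1 (suc n) = trans (*-identityˡ _) (1^n≈1 n)

  dehomogenise : ∀ {d} (a : Vector Carrier (suc d)) x → evalForm a x 1# ≈ evalPoly a x
  dehomogenise {d} a x = sum-cong-≋ {x = formTerm a x 1#} {λ i → a i * x ^ toℕ i} λ i →
    *-congˡ (trans (*-congˡ (1^n≈1 (d ∸ toℕ i))) (*-identityʳ _))

  evalForm-linear : ∀ {d} s t (a b : Vector Carrier (suc d)) x y →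
    evalForm (λ i → s * a i + t * b i) x y ≈ s * evalForm a x y + t * evalForm b x y
  evalForm-linear s t a b x y = begin
    evalForm (λ i → s * a i + t * b i) x y
      ≈⟨ sum-cong-≋ {x = formTerm (λ i → s * a i + t * b i) x y} {λ i → f i + g i} (λ i →
           trans (distribʳ _ _ _) (+-cong (*-assoc s _ _) (*-assoc t _ _))) ⟩
    sum (λ i → f i + g i)
      ≈⟨ ∑-distrib-+ f g ⟩
    sum f + sum g
      ≈⟨ +-cong (*-distribˡ-sum s (formTerm a x y)) (*-distribˡ-sum t (formTerm b x y)) ⟨
    s * evalForm a x y + t * evalForm b x y ∎
    where
    f g : Vector Carrier _
    f i = s * formTerm a x y i
    g i = t * formTerm b x y i

  -- If every coefficient but that of Yᵈ vanishes, then [1 ∶ 0] is a root.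
  form-root : ExcludedMiddle ℓ₂ → IsAlgebraicallyClosed F →
              ∀ {d} → 1 ≤ d → (a : Vector Carrier (suc d)) →
              ∃ λ (P : Point) → evalForm a (Point.X P) (Point.Y P) ≈ 0#
  form-root em closed {suc d} _ a with em {∃ λ i → a (suc i) # 0#}
  ... | yes nonconstant with closed (suc d) a nonconstant
  ...   | x , ax≈0 = [ x ∶ 1# ]⟨ inj₂ 1#0 ⟩ , trans (dehomogenise a x) ax≈0
  form-root em closed {suc d} _ a | no constant = [ 1# ∶ 0# ]⟨ inj₁ 1#0 ⟩ ,
    trans (sum-cong-≋ {x = formTerm a 1# 0#} {λ _ → 0#} term≈0) (sum-replicate-zero (suc (suc d)))
    where
    term≈0 : ∀ i → formTerm a 1# 0# i ≈ 0#
    -- The degree `suc d` is positive, so the pure power of Y has a factor `0#` at [1 ∶ 0].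
    term≈0 zero    = trans (*-congˡ (trans (*-congˡ (zeroˡ _)) (zeroʳ _))) (zeroʳ _)
    term≈0 (suc i) = trans (*-congʳ (proj₁ (HeytingField.tight F _ _) λ ai#0 → constant (i , ai#0)))
                           (zeroˡ _)

  xy#0⇒x#0 : ∀ {x y} → x * y # 0# → x # 0#
  xy#0⇒x#0 {x} {y} xy#0 with inverse xy#0
  ... | z , z[xy]≈1 = invertible⇒#0 {x⁻¹ = z * y} (begin
    z * y * x    ≈⟨ *-assoc z y x ⟩
    z * (y * x)  ≈⟨ *-congˡ (*-comm y x) ⟩
    z * (x * y)  ≈⟨ z[xy]≈1 ⟩
    1#           ∎)

  proportional : ∀ {x y u v} → x # 0# → v * x ≈ u * y → ∃ λ s → u ≈ s * x × v ≈ s * y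
  proportional {x} {y} {u} {v} x#0 vx≈uy with inverse x#0
  ... | x⁻¹ , x⁻¹x≈1 = u * x⁻¹ , cancel u , (begin
    v              ≈⟨ cancel v ⟩
    v * x⁻¹ * x    ≈⟨ xy∙z≈xz∙y v x⁻¹ x ⟩
    v * x * x⁻¹    ≈⟨ *-congʳ vx≈uy ⟩
    u * y * x⁻¹    ≈⟨ xy∙z≈xz∙y u y x⁻¹ ⟩
    u * x⁻¹ * y    ∎)
    where
    cancel : ∀ w → w ≈ w * x⁻¹ * x
    cancel w = begin
      w              ≈⟨ *-identityʳ w ⟨
      w * 1#         ≈⟨ *-congˡ x⁻¹x≈1 ⟨
      w * (x⁻¹ * x)  ≈⟨ *-assoc w x⁻¹ x ⟨
      w * x⁻¹ * x    ∎

  -- A nonzero coordinate of `P` gives the scale as a quotient. The scale is nonzero because a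
  -- nonzero coordinate of `Q` is a multiple of it.
  cross⇒∼ : ∀ {P Q} → Point.Y Q * Point.X P ≈ Point.X Q * Point.Y P → P ∼ Q
  cross⇒∼ {P} {Q} vx≈uy = scaled (Point.nonzero P) (Point.nonzero Q)
    where
    nonzero-scale : ∀ {s x u} → u # 0# → u ≈ s * x → s # 0#
    nonzero-scale u#0 u≈sx = xy#0⇒x#0 (#-congʳ u≈sx u#0)

    scale-by : (∃ λ s → Point.X Q ≈ s * Point.X P × Point.Y Q ≈ s * Point.Y P) →
               NonZeroPair (Point.X Q) (Point.Y Q) → P ∼ Q
    scale-by (s , p , q) (inj₁ u#0) = scaleBy s (nonzero-scale u#0 p) p q
    scale-by (s , p , q) (inj₂ v#0) = scaleBy s (nonzero-scale v#0 q) p q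

    scaled : NonZeroPair (Point.X P) (Point.Y P) → NonZeroPair (Point.X Q) (Point.Y Q) → P ∼ Q
    scaled (inj₁ x#0) = scale-by (proportional x#0 vx≈uy)
    -- The two coordinates exchange roles here, so the resulting equations come out in the opposite
    -- order.
    scaled (inj₂ y#0) with proportional y#0 (sym vx≈uy)
    ... | s , q , p = scale-by (s , p , q)

-- Field homomorphisms and evaluation of forms.

module Homomorphism {F : HeytingField c ℓ₁ ℓ₂} {E : HeytingField c′ ℓ₁′ ℓ₂′} (h : FieldHom F E) where

  private
    module F = FieldOps F
    module E = FieldOps E
  open FieldHom h

  sum-homo : ∀ {n} (f : Vector F.Carrier n) → ⟦ F.sum f ⟧ E.≈ E.sum (map ⟦_⟧ f)
  sum-homo {zero}  f = 0#-homo
  sum-homo {suc n} f = E.trans (+-homo _ _) (E.+-congˡ (sum-homo (f ∘ suc)))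

  ^-homo : ∀ x n → ⟦ x F.^ n ⟧ E.≈ ⟦ x ⟧ E.^ n
  ^-homo x zero    = 1#-homo
  ^-homo x (suc n) = E.trans (*-homo _ _) (E.*-congˡ (^-homo x n))

  evalForm-homo : ∀ {d} (a : Vector F.Carrier (suc d)) x y →
                  ⟦ F.evalForm a x y ⟧ E.≈ E.evalForm (map ⟦_⟧ a) ⟦ x ⟧ ⟦ y ⟧
  evalForm-homo {d} a x y = E.trans (sum-homo (F.formTerm a x y))
    (E.sum-cong-≋ {x = map ⟦_⟧ (F.formTerm a x y)} {E.formTerm (map ⟦_⟧ a) ⟦ x ⟧ ⟦ y ⟧} λ i →
      E.trans (*-homo _ _) (E.*-congˡ
        (E.trans (*-homo _ _) (E.*-cong (^-homo x (toℕ i)) (^-homo y (d ∸ toℕ i))))))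

-- Rational maps, their iterates and the Galois action.

module _ {K : HeytingField c ℓ₁ ℓ₂} (K̄ : AlgebraicClosure K c′ ℓ₁′ ℓ₂′) where

  open Dynamics K̄
  open AlgebraicClosure K̄ using (embed; algebraicallyClosed) renaming (heytingField to L)
  private
    module K = FieldOps K
    module L = FieldOps L
    module ℙ = Setoid L.ℙ¹
  open FieldHom embed using (⟦_⟧)
  open Forms L
  open RingProperties L.ring using (-‿distribˡ-*; x∙y⁻¹≈ε⇒x≈y)

  -- The action of `idGal` keeps the coordinates of `P` but rebuilds its nonvanishing proof, so the
  -- scaling data are unpacked and reassembled.
  ∼⇒Conjugate : ∀ {P Q} → P L.∼ Q → Conjugate P Q
  ∼⇒Conjugate (L.scaleBy s s#0 p q) = conjugateBy idGal (L.scaleBy s s#0 p q)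

  module _ (φ : RationalMap) where

    open RationalMap φ
    private module Endo = SetoidEndo L.ℙ¹

    -- The preimages of [u ∶ v] are the roots of the binary form v·N - u·D, with N and D the
    -- numerator and denominator. At a root, v·N and u·D agree, which is the cross relation for
    -- `cross⇒∼`.
    toFunc-surjective : ExcludedMiddle ℓ₂′ → 1 ≤ degree →
                        StrictlySurjective L._∼_ (Func.to toFunc)
    toFunc-surjective em 1≤d L.[ u ∶ v ]⟨ _ ⟩ = P , cross⇒∼ (x∙y⁻¹≈ε⇒x≈y _ _ (begin
      v L.* N L.+ L.- (u L.* D)  ≈⟨ L.+-congˡ (-‿distribˡ-* u D) ⟩
      v L.* N L.+ L.- u L.* D    ≈⟨ evalForm-linear v (L.- u) (map ⟦_⟧ numerator) (map ⟦_⟧ denominator) x y ⟨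
      L.evalForm vN-uD x y       ≈⟨ proj₂ root ⟩
      L.0#                       ∎))
      where
      open ≈-Reasoning L.setoid
      vN-uD : Vector L.Carrier (suc degree)
      vN-uD i = v L.* ⟦ numerator i ⟧ L.+ L.- u L.* ⟦ denominator i ⟧
      root : ∃ λ P → L.evalForm vN-uD (L.Point.X P) (L.Point.Y P) L.≈ L.0#
      root = form-root em algebraicallyClosed 1≤d vN-uD
      P : L.Point
      P = proj₁ root
      x y N D : L.Carrier
      x = L.Point.X P
      y = L.Point.Y P
      N = evalOver numerator x y
      D = evalOver denominator x y

    -- The coefficients come from `K`, so a Galois automorphism passes through both forms and moves
    -- only the arguments.
    act-toFunc : ∀ g P → Func.to (Gal.act g) (Func.to toFunc P) L.∼
                         Func.to toFunc (Func.to (Gal.act g) P)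
    act-toFunc g L.[ x ∶ y ]⟨ _ ⟩ =
      L.coords⇒∼ (L.sym (equivariant numerator)) (L.sym (equivariant denominator))
      where
      module g = Gal g
      open Homomorphism g.fieldHom
      equivariant : ∀ {d} (a : Vector K.Carrier (suc d)) →
                    g.σ (evalOver a x y) L.≈ evalOver a (g.σ x) (g.σ y)
      equivariant a = L.trans (evalForm-homo (map ⟦_⟧ a) x y)
        (L.sum-cong-≋ {x = L.formTerm (map (g.σ ∘ ⟦_⟧) a) (g.σ x) (g.σ y)}
                      {L.formTerm (map ⟦_⟧ a) (g.σ x) (g.σ y)} λ i → L.*-congʳ (g.fixes (a i)))

    iterate-cong : ∀ n → Congruent L._∼_ L._∼_ (iterate φ n)
    iterate-cong n = Func.cong (toFunc Endo.^ n)

    -- `iterate` unfolds by applying the map to the point first, so the `m` initial steps peel off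
    -- definitionally; hence the order `m + l` in later types.
    iterate-+ : ∀ m l P → iterate φ (m ℕ.+ l) P ≡ iterate φ l (iterate φ m P)
    iterate-+ zero    l P = ≡.refl
    iterate-+ (suc m) l P = iterate-+ m l (Func.to toFunc P)

    Preimage-∘ : ∀ m l {α β γ} → γ ∈ Preimage φ m α → α ∈ Preimage φ l β →
                 γ ∈ Preimage φ (m ℕ.+ l) β
    Preimage-∘ m l {γ = γ} γ↦α α↦β rewrite iterate-+ m l γ = ℙ.trans (iterate-cong l γ↦α) α↦β

    iterate-surjective : ExcludedMiddle ℓ₂′ → 1 ≤ degree → ∀ n →
                         StrictlySurjective L._∼_ (iterate φ n)
    iterate-surjective em 1≤d zero    Q = Q , ℙ.refl
    iterate-surjective em 1≤d (suc n) Q = proj₁ φ-fibre ,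
      ℙ.trans (iterate-cong n (proj₂ φ-fibre)) (proj₂ φⁿ-fibre)
      where
      φⁿ-fibre : ∃ λ P → iterate φ n P L.∼ Q
      φⁿ-fibre = iterate-surjective em 1≤d n Q
      φ-fibre : ∃ λ P → Func.to toFunc P L.∼ proj₁ φⁿ-fibre
      φ-fibre = toFunc-surjective em 1≤d (proj₁ φⁿ-fibre)

    act-iterate : ∀ g n P → Func.to (Gal.act g) (iterate φ n P) L.∼
                            iterate φ n (Func.to (Gal.act g) P)
    act-iterate g zero    P = ℙ.refl
    act-iterate g (suc n) P =
      ℙ.trans (act-iterate g n (Func.to toFunc P)) (iterate-cong n (act-toFunc g P))

    -- The same automorphism conjugates the images, so iterates descend to Galois orbits.
    iterate-conjugate : ∀ n → Congruent Conjugate Conjugate (iterate φ n)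
    iterate-conjugate n {P} (conjugateBy g gP∼Q) =
      conjugateBy g (ℙ.trans (act-iterate g n P) (iterate-cong n gP∼Q))

    project : ∀ β m l → ∃ (Preimage φ (m ℕ.+ l) β) → ∃ (Preimage φ l β)
    project β m l (γ , γ∈) = iterate φ m γ , ≡.subst (L._∼ β) (iterate-+ m l γ) γ∈

    -- A point that `iterate φ m` sends to `α` lies in the larger preimage set by composition.
    project-surjective : ExcludedMiddle ℓ₂′ → 1 ≤ degree → ∀ β m l →
      StrictlySurjective (Setoid._≈_ (Orbits (Preimage φ l β))) (project β m l)
    project-surjective em 1≤d β m l (α , α∈) =
      (proj₁ fibre , Preimage-∘ m l (proj₂ fibre) α∈) , ∼⇒Conjugate (proj₂ fibre)
      where
      fibre : ∃ λ γ → iterate φ m γ L.∼ α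
      fibre = iterate-surjective em 1≤d m α

-- Stabilisation of the number of orbits.

theorem2p6 : ∀ {c ℓ₁ ℓ₂ c′ ℓ₁′ ℓ₂′ : Level} →
    ExcludedMiddle (c ⊔ ℓ₁ ⊔ ℓ₂ ⊔ c′ ⊔ ℓ₁′ ⊔ ℓ₂′) →
    (K : NumberField c ℓ₁ ℓ₂) →
    (K̄ : AlgebraicClosure (NumberField.heytingField K) c′ ℓ₁′ ℓ₂′) →
    let open Dynamics K̄ in
    (φ : RationalMap) → 2 ≤ RationalMap.degree φ →
    (β : FieldOps.Point (NumberField.heytingField K)) →
    (∃ λ (C : ℕ) → ∀ (n : ℕ) → ∃ λ (k : ℕ) →
    k ≤ C × HasCardinality (Orbits (Preimage φ n (baseChange β))) k) →
    ∃ λ (l : ℕ) →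
    ∀ α → α ∈ Preimage φ l (baseChange β) →
    ∀ (m : ℕ) →
    ∀ γ γ′ → γ ∈ Preimage φ m α → γ′ ∈ Preimage φ m α →
    Conjugate γ γ′
theorem2p6 {c} {ℓ₁} {ℓ₂} {c′} {ℓ₁′} {ℓ₂′} em K K̄ φ 2≤d β (C , orbits)
  with bounded⇒maximum (lowerEM (c ⊔ ℓ₁ ⊔ ℓ₂ ⊔ c′ ⊔ ℓ₁′ ⊔ ℓ₂′) em)
         (λ n → proj₁ (orbits n)) (λ n → proj₁ (proj₂ (orbits n)))
... | l , maximal = l , λ α α∈ m γ γ′ γ∈ γ′∈ →
  -- Maximality at `l` bounds the orbit count of the source, at `m + l`, by that of the target.
  surjective⇒injective (#orbits (m ℕ.+ l)) (#orbits l) (maximal (m ℕ.+ l))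
    (project K̄ φ (baseChange β) m l)
    (λ {x} {y} → iterate-conjugate K̄ φ m {proj₁ x} {proj₁ y})
    (project-surjective K̄ φ (lowerEM (c ⊔ ℓ₁ ⊔ ℓ₂ ⊔ c′ ⊔ ℓ₁′) em) (<⇒≤ 2≤d) (baseChange β) m l)
    {γ , Preimage-∘ K̄ φ m l γ∈ α∈} {γ′ , Preimage-∘ K̄ φ m l γ′∈ α∈}
    -- Both images are the projective point `α`, hence lie in one orbit.
    (∼⇒Conjugate K̄ (ℙ.trans γ∈ (ℙ.sym γ′∈)))
  where
  open Dynamics K̄ using (baseChange)
  module ℙ = Setoid (FieldOps.ℙ¹ (AlgebraicClosure.heytingField K̄))
  #orbits = λ n → proj₂ (proj₂ (orbits n))
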